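{- For all integers $n,h,b\ge0$, $G_n(h,b)=H_n(h,b)$, where $G_n(h,b)=|\mathcal{B}^{(h,b)}_{n+1}(231)|$ and $H_n(h,b)=|\mathcal{H}(n;h,b)|$. In particular, for every $n\ge1$, $|\mathcal{B}_n(231)|=C(\lfloor n/2\rfloor)\,C(\lfloor (n+1)/2\rfloor)$, where $C(m)=\frac{1}{m+1}\binom{2m}{m}$.
   Context: For integers $h,b\ge0$, a permutation $\pi\in\mathfrak{S}_{n+1}$ is an $(h,b)$-ballot permutation if the lattice path starting at $(0,h)$ whose $i$th step ($i\in[n]$) is $(1,1)$ if $\pi_i<\pi_{i+1}$ and $(1,-1)$ if $\pi_i>\pi_{i+1}$ ends at $(n,b)$ and never goes below the $x$-axis. Ballot permutations $\mathcal{B}_m$ are the $(0,b)$-ballot permutations in $\mathfrak{S}_m$ for some $b\ge0$ (every prefix has at most as many descents as ascents). $\mathcal{B}^{(h,b)}_{n+1}(231)$ (resp. $\mathcal{B}_m(231)$) denotes those with no subsequence order-isomorphic to $231$. A Gouyou-Beauchamps (GB) walk is a lattice path confined to $\{(x,y)\in\mathbb{N}^2: y\le x\}$ with steps from $\{(0,1),(0,-1),(-1,0),(1,0)\}$; $\mathcal{H}(n;h,b)$ is the set of $n$-step GB walks from $(h,0)$ to $(b,0)$. -}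

module Defs where

open import Data.Bool.Base using (if_then_else_)
open import Data.Fin.Base as Fin using (Fin; zero; suc)
import Data.Fin.Properties as Fin
open import Data.Integer.Base as ℤ using (ℤ; +_; ∣_∣; 0ℤ; 1ℤ; -1ℤ)
import Data.Integer.Properties as ℤ
open import Data.List.Base as List
  using (List; []; _∷_; length; filter; allFin; cartesianProductWith)
open import Data.List.Membership.Propositional using (_∈_; lose; find)
open import Data.List.Membership.Propositional.Properties
  using (∈-allFin; ∈-cartesianProductWith⁺; ∈-cartesianProductWith⁻)
import Data.List.Relation.Unary.Any as ListAny
import Data.List.Relation.Unary.All as ListAll
import Data.List.Relation.Unary.AllPairs as ListAllPairs
import Data.List.Relation.Unary.Unique.Propositional as ListUnique
import Data.List.Relation.Unary.Unique.Propositional.Properties as ListUnique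
open import Data.Nat.Base using (ℕ; zero; suc; pred; _+_; _*_; _/_)
open import Data.Nat.Combinatorics using (_C_; nC1≡n; nCk+nC[k+1]≡[n+1]C[k+1])
open import Data.Nat.Divisibility using (_∣_; divides; ∣m+n∣m⇒∣n)
import Data.Nat.Properties as ℕ
open import Data.Nat.Tactic.RingSolver using (solve-∀)
open import Data.Product.Base using (_×_; _,_; proj₁; proj₂; ∃-syntax)
open import Data.Product.Properties using (≡-dec)
open import Data.Vec.Base using (Vec; []; _∷_; lookup; last; map)
open import Data.Vec.Properties using (∷-injective)
open import Data.Vec.Relation.Unary.All as All using (All; []; _∷_; all?)
open import Data.Vec.Relation.Unary.AllPairs using (AllPairs; allPairs?)
open import Data.Vec.Relation.Unary.Unique.Propositional using (Unique)
open import Function.Bundles using (_⇔_; mk⇔; Equivalence)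
open import Level using (Level)
open import Relation.Binary.Definitions using (DecidableEquality)
open import Relation.Binary.PropositionalEquality
  using (_≡_; refl; sym; trans; cong; cong₂; module ≡-Reasoning)
open import Relation.Nullary.Decidable
  using (Dec; map′; ¬?; _×-dec_; _→-dec_; does)
open import Relation.Nullary.Negation using (¬_)
open import Relation.Unary using (Pred; Decidable)

private
  variable
    a p : Level
    A : Set a
    k m n : ℕ

-- A cardinality, since it is applied only to duplicate-free lists (see words-unique).
count : {P : Pred A p} → Decidable P → List A → ℕ
count P? xs = length (filter P? xs)

words : List A → (n : ℕ) → List (Vec A n)
words xs zero    = [] ∷ []
words xs (suc n) = cartesianProductWith _∷_ xs (words xs n)

∈-words⁺ : {xs : List A} {v : Vec A n} → All (_∈ xs) v → v ∈ words xs n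
∈-words⁺ []         = ListAny.here refl
∈-words⁺ (x∈ ∷ vs∈) = ∈-cartesianProductWith⁺ _∷_ x∈ (∈-words⁺ vs∈)

∈-words⁻ : (xs : List A) {v : Vec A n} → v ∈ words xs n → All (_∈ xs) v
∈-words⁻ {n = zero}  xs {[]} _ = []
∈-words⁻ {n = suc n} xs v∈
  with _ , _ , x∈ , vs∈ , refl ← ∈-cartesianProductWith⁻ _∷_ xs (words xs n) v∈
  = x∈ ∷ ∈-words⁻ xs vs∈

words-unique : {xs : List A} → ListUnique.Unique xs → ∀ n → ListUnique.Unique (words xs n)
words-unique xs! zero    = ListAll.[] ListAllPairs.∷ ListAllPairs.[]
words-unique xs! (suc n) =
  ListUnique.cartesianProductWith⁺ _∷_ ∷-injective xs! (words-unique xs! n)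

∈-words-allFin : (v : Vec (Fin m) n) → v ∈ words (allFin m) n
∈-words-allFin v = ∈-words⁺ (All.universal ∈-allFin v)

ℤ² : Set
ℤ² = ℤ × ℤ

_≟²_ : DecidableEquality ℤ²
_≟²_ = ≡-dec ℤ._≟_ ℤ._≟_

-- All lattice points visited, including the starting point.
path : ℤ² → Vec ℤ² n → Vec ℤ² (suc n)
path p           []             = p ∷ []
path p@(x , y) ((dx , dy) ∷ ss) = p ∷ path (x ℤ.+ dx , y ℤ.+ dy) ss

-- One-line notation of a permutation of {1,…,m}, all values shifted down by one.
IsPermutation : Vec (Fin m) m → Set
IsPermutation π = Unique π

isPermutation? : Decidable (IsPermutation {m})
isPermutation? = allPairs? λ i j → ¬? (i Fin.≟ j)

OrderIsomorphic : Vec (Fin m) k → Vec (Fin n) k → Set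
OrderIsomorphic u v =
  ∀ i j → (lookup u i Fin.< lookup u j) ⇔ (lookup v i Fin.< lookup v j)

orderIsomorphic? : (u : Vec (Fin m) k) (v : Vec (Fin n) k) → Dec (OrderIsomorphic u v)
orderIsomorphic? u v = Fin.all? λ i → Fin.all? λ j →
  let P? = lookup u i Fin.<? lookup u j
      Q? = lookup v i Fin.<? lookup v j
  in map′ (λ (f , g) → mk⇔ f g)
          (λ e → Equivalence.to e , Equivalence.from e)
          ((P? →-dec Q?) ×-dec (Q? →-dec P?))

Contains : Vec (Fin k) k → Vec (Fin m) m → Set
Contains {k} {m} τ π = ∃[ is ] Occurrence is
  where
  Occurrence : Vec (Fin m) k → Set
  Occurrence is = AllPairs Fin._<_ is × OrderIsomorphic (map (lookup π) is) τ

contains? : (τ : Vec (Fin k) k) → Decidable (Contains {m = m} τ)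
contains? {k} {m} τ π =
  map′ (λ any → let is , _ , occ = find any in is , occ)
       (λ (is , occ) → lose (∈-words-allFin is) occ)
       (ListAny.any? (λ is → allPairs? Fin._<?_ is ×-dec orderIsomorphic? (map (lookup π) is) τ)
                     (words (allFin m) k))

Avoids : Vec (Fin k) k → Vec (Fin m) m → Set
Avoids τ π = ¬ Contains τ π

avoids? : (τ : Vec (Fin k) k) → Decidable (Avoids {m = m} τ)
avoids? τ π = ¬? (contains? τ π)

-- 231, shifted down by one.
pattern231 : Vec (Fin 3) 3
pattern231 = suc zero ∷ suc (suc zero) ∷ zero ∷ []

-- Only used on words with distinct letters, where the second branch
-- means i > j.
ascentStep : Fin m → Fin m → ℤ²
ascentStep i j = if does (i Fin.<? j) then (1ℤ , 1ℤ) else (1ℤ , -1ℤ)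

steps : Vec (Fin m) n → Vec ℤ² (pred n)
steps []           = []
steps (i ∷ [])     = []
steps (i ∷ j ∷ is) = ascentStep i j ∷ steps (j ∷ is)

ballotPath : ℕ → Vec (Fin m) m → Vec ℤ² (suc (pred m))
ballotPath h π = path (0ℤ , + h) (steps π)

NotBelowAxis : ℤ² → Set
NotBelowAxis (x , y) = 0ℤ ℤ.≤ y

record IsBallotFromTo (h b : ℕ) (π : Vec (Fin m) m) : Set where
  constructor mkBallot
  field
    isPermutation : IsPermutation π
    endpoint      : last (ballotPath h π) ≡ (+ pred m , + b)
    notBelowAxis  : All NotBelowAxis (ballotPath h π)

isBallotFromTo? : ∀ h b → Decidable (IsBallotFromTo {m} h b)
isBallotFromTo? {m} h b π =
  map′ (λ (p , e , q) → mkBallot p e q)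
       (λ (mkBallot p e q) → p , e , q)
       (isPermutation? π
         ×-dec (last (ballotPath h π) ≟² (+ pred m , + b))
         ×-dec all? (λ (x , y) → 0ℤ ℤ.≤? y) (ballotPath h π))

IsBallot : Vec (Fin m) m → Set
IsBallot π = ∃[ b ] IsBallotFromTo 0 b π

-- The only possible value of b is read off the end of the path.
isBallot? : Decidable (IsBallot {m})
isBallot? {m} π = map′ (b₀ ,_) to (isBallotFromTo? 0 b₀ π)
  where
  b₀ : ℕ
  b₀ = ∣ proj₂ (last (ballotPath 0 π)) ∣

  to : IsBallot π → IsBallotFromTo 0 b₀ π
  to (b , mkBallot p e q) =
    mkBallot p (trans e (cong (λ c → (+ pred m , + c)) (sym (cong (λ z → ∣ proj₂ z ∣) e)))) q

G : (n h b : ℕ) → ℕ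
G n h b = count (λ π → isBallotFromTo? h b π ×-dec avoids? pattern231 π)
                (words (allFin (suc n)) (suc n))

numBallot231 : ℕ → ℕ
numBallot231 m = count (λ π → isBallot? π ×-dec avoids? pattern231 π)
                       (words (allFin m) m)

gbSteps : List ℤ²
gbSteps = (0ℤ , 1ℤ) ∷ (0ℤ , -1ℤ) ∷ (-1ℤ , 0ℤ) ∷ (1ℤ , 0ℤ) ∷ []

InWedge : ℤ² → Set
InWedge (x , y) = 0ℤ ℤ.≤ x × 0ℤ ℤ.≤ y × y ℤ.≤ x

inWedge? : Decidable InWedge
inWedge? (x , y) = (0ℤ ℤ.≤? x) ×-dec (0ℤ ℤ.≤? y) ×-dec (y ℤ.≤? x)

-- The steps themselves are drawn from gbSteps in the definition of H.
IsGBWalk : (h b : ℕ) → Vec ℤ² n → Set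
IsGBWalk h b w = All InWedge (path (+ h , 0ℤ) w)
               × last (path (+ h , 0ℤ) w) ≡ (+ b , 0ℤ)

isGBWalk? : ∀ h b → Decidable (IsGBWalk {n} h b)
isGBWalk? h b w = all? inWedge? (path (+ h , 0ℤ) w)
           ×-dec (last (path (+ h , 0ℤ) w) ≟² (+ b , 0ℤ))

H : (n h b : ℕ) → ℕ
H n h b = count (isGBWalk? h b) (words gbSteps n)

-- The division is exact, see catalan-exact.
catalan : ℕ → ℕ
catalan m = ((2 * m) C m) / suc m

binomial-ratio : ∀ n k → suc k * (n C suc k) + k * (n C k) ≡ n * (n C k)
binomial-ratio zero    zero    = refl
binomial-ratio zero    (suc k) =
  cong₂ _+_ (ℕ.*-zeroʳ (suc (suc k))) (ℕ.*-zeroʳ (suc k))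
binomial-ratio (suc n) zero    =
  trans (cong (λ c → 1 * c + 0) (nC1≡n (suc n))) (lemma (suc n))
  where
  lemma : ∀ n → 1 * n + 0 ≡ n * 1
  lemma = solve-∀
binomial-ratio (suc n) (suc k) = begin
  suc (suc k) * (suc n C suc (suc k)) + suc k * (suc n C suc k)
    ≡⟨ cong₂ (λ x y → suc (suc k) * x + suc k * y)
             (sym (nCk+nC[k+1]≡[n+1]C[k+1] n (suc k)))
             (sym (nCk+nC[k+1]≡[n+1]C[k+1] n k)) ⟩
  suc (suc k) * (c₁ + c₂) + suc k * (c₀ + c₁)
    ≡⟨ regroup k c₀ c₁ c₂ ⟩
  (suc (suc k) * c₂ + suc k * c₁) + (suc k * c₁ + k * c₀) + (c₀ + c₁)
    ≡⟨ cong₂ (λ x y → x + y + (c₀ + c₁)) (binomial-ratio n (suc k)) (binomial-ratio n k) ⟩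
  n * c₁ + n * c₀ + (c₀ + c₁)
    ≡⟨ collect n c₀ c₁ ⟩
  suc n * (c₀ + c₁)
    ≡⟨ cong (suc n *_) (nCk+nC[k+1]≡[n+1]C[k+1] n k) ⟩
  suc n * (suc n C suc k) ∎
  where
  open ≡-Reasoning
  c₀ = n C k
  c₁ = n C suc k
  c₂ = n C suc (suc k)

  regroup : ∀ k c₀ c₁ c₂ → suc (suc k) * (c₁ + c₂) + suc k * (c₀ + c₁)
          ≡ (suc (suc k) * c₂ + suc k * c₁) + (suc k * c₁ + k * c₀) + (c₀ + c₁)
  regroup = solve-∀

  collect : ∀ n c₀ c₁ → n * c₁ + n * c₀ + (c₀ + c₁) ≡ suc n * (c₀ + c₁)
  collect = solve-∀

catalan-exact : ∀ m → suc m ∣ ((2 * m) C m)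
catalan-exact m = ∣m+n∣m⇒∣n {n = c} (divides c (swap m c)) (divides c′ (trans eq (ℕ.*-comm (suc m) c′)))
  where
  c c′ : ℕ
  c  = (2 * m) C m
  c′ = (2 * m) C suc m

  swap : ∀ m c → m * c + c ≡ c * suc m
  swap = solve-∀

  double : ∀ m c → (2 * m) * c ≡ m * c + m * c
  double = solve-∀

  eq : m * c ≡ suc m * c′
  eq = sym (ℕ.+-cancelʳ-≡ (m * c) (suc m * c′) (m * c)
             (trans (binomial-ratio (2 * m) m) (double m c)))

{-# OPTIONS --safe #-}

-- For a 231-avoiding permutation π let r(π) be its number of direct sum components minus one.
-- Prepending a letter keeps π 231-avoiding exactly at the r + 2 cuts between components (the
-- outer two included): the lowest cut gives an ascent and r + 1 components above the first, each
-- other cut a descent, and these realise every value 0, …, r once. Hence, if N(n, h, i) is the sum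
-- of C(r(π), i) over the 231-avoiding ballot permutations of length n + 1 starting at height h,
-- Pascal's rule and the hockey-stick identity give
--   N(n+1, h, i) = N(n, h+1, i) + N(n, h+1, i−1) + N(n, h−1, i) + N(n, h−1, i+1),
-- which is the first-step recursion of GB walks from (h + i, i); take i = 0.
--
-- For the product formula, rotating by 45° turns a GB walk into two non-colliding ±1 walks on
-- the half-line, so the walks from the origin to the x-axis are counted by a 2 × 2 determinant
-- summed over endpoints. With p(k) the number of n-step half-line walks from 0 to k, the sum
-- telescopes to p(0)² + p(1)² + p(0) p(2), where by parity only one of p(0), p(1) is non-zero.

module Submission where

open import Data.Bool.Base using (true; false; if_then_else_)
open import Data.Fin.Base as Fin using (Fin; zero; suc; toℕ; punchIn; punchOut)
import Data.Fin.Properties as Fin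
open import Data.Integer.Base as ℤ using (+_; -[1+_]; 0ℤ; 1ℤ; -1ℤ)
import Data.Integer.Properties as ℤ
open import Data.List.Base as List using (List; []; _∷_; cartesianProductWith; filter; allFin)
import Data.List.Properties as List
open import Data.List.Membership.Propositional using (_∈_)
open import Data.List.Membership.Propositional.Properties
  using (∈-filter⁺; ∈-filter⁻; ∈-map⁺; ∈-cartesianProductWith⁺; ∈-allFin)
open import Data.List.Membership.Propositional.Properties.WithK using (unique∧set⇒bag)
open import Data.List.Relation.Binary.BagAndSetEquality using (∼bag⇒↭)
open import Data.List.Relation.Binary.Permutation.Propositional.Properties using (↭-length)
import Data.List.Relation.Unary.All as ListAll
import Data.List.Relation.Unary.AllPairs as ListAllPairs
import Data.List.Relation.Unary.Any as ListAny
import Data.List.Relation.Unary.Unique.Propositional as ListUnique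
import Data.List.Relation.Unary.Unique.Propositional.Properties as ListUnique
open import Data.Nat.Base
open import Data.Nat.Combinatorics using (_C_; nCk≡nC[n∸k]; nCk+nC[k+1]≡[n+1]C[k+1]; k>n⇒nCk≡0)
open import Data.Nat.DivMod using (m*n/n≡m; m/n≡1+[m∸n]/n)
open import Data.Nat.ListAction using (sum)
open import Data.Nat.ListAction.Properties using (sum-++)
open import Data.Nat.Properties
open import Data.Nat.Tactic.RingSolver using (solve-∀)
open import Data.Product.Base using (_×_; _,_; proj₁; proj₂; ∃-syntax)
open import Data.Sum.Base using (_⊎_; inj₁; inj₂)
open import Data.Unit.Base using (⊤; tt)
open import Data.Vec.Base as Vec using (Vec; []; _∷_; last; lookup)
import Data.Vec.Properties as Vec
open import Data.Vec.Relation.Unary.All as All using (All; []; _∷_)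
open import Data.Vec.Relation.Unary.AllPairs using ([]; _∷_)
open import Data.Vec.Relation.Unary.Unique.Propositional using (Unique)
import Data.Vec.Relation.Unary.Unique.Propositional.Properties as Unique
open import Function.Base using (_∘_; const)
open import Function.Bundles using (_⇔_; mk⇔; Equivalence)
open import Level using (Level)
open import Relation.Binary.PropositionalEquality
open import Relation.Nullary.Decidable using (Dec; yes; no; does; _×-dec_; dec-false; does-⇔)
open import Relation.Nullary.Negation using (¬_; contradiction)
open import Relation.Unary using (Pred; Decidable)
open import Defs

private
  variable
    ℓ ℓ₁ ℓ₂ ℓ₃ : Level
    A : Set ℓ₁
    B : Set ℓ₂
    D : Set ℓ₃
    k m n : ℕ

-- Determinant formula for Gouyou-Beauchamps walks

-- The value 0 at the boundary stands for a forbidden step.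
pre : (ℕ → ℕ) → ℕ → ℕ
pre f zero    = 0
pre f (suc k) = f k

-- n-step GB walks from (v + y , y) to the x-axis, an endpoint (x , 0) being
-- weighted by φ x. In the coordinates v = x − y and y the wedge is a quadrant.
gb : (ℕ → ℕ) → ℕ → ℕ → ℕ → ℕ
gb φ zero    v zero    = φ v
gb φ zero    v (suc y) = 0
gb φ (suc n) v y       = gb φ n (suc v) y + pre (gb φ n (suc v)) y
                       + pre (λ v → gb φ n v y + gb φ n v (suc y)) v

δ : ℕ → ℕ → ℕ
δ zero    zero    = 1
δ zero    (suc k) = 0
δ (suc u) zero    = 0
δ (suc u) (suc k) = δ u k

halfLine : ℕ → ℕ → ℕ → ℕ
halfLine zero    u k = δ u k
halfLine (suc n) u k = halfLine n (suc u) k + pre (λ u → halfLine n u k) u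

-- The recursion of `halfLine` peels off the first step, as the determinant needs; telescoping and
-- reflection move the endpoint and need the last step. Away from `n = 0` the two operations
-- commute.
halfLine-last : ∀ n u k → halfLine (suc n) u k ≡ halfLine n u (suc k) + pre (halfLine n u) k
halfLine-last zero zero    zero    = refl
halfLine-last zero zero    (suc zero) = refl
halfLine-last zero zero    (suc (suc k)) = refl
halfLine-last zero (suc zero) zero = refl
halfLine-last zero (suc (suc u)) zero = refl
halfLine-last zero (suc u) (suc k) = +-comm (δ (suc u) k) (δ u (suc k))
halfLine-last (suc n) zero k
  rewrite halfLine-last n 1 k = lemma k
  where
  lemma : ∀ k → halfLine n 1 (suc k) + pre (halfLine n 1) k + 0
        ≡ halfLine n 1 (suc k) + 0 + pre (halfLine (suc n) 0) k
  lemma zero    = refl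
  lemma (suc k) = ring (halfLine n 1 (2 + k)) (halfLine n 1 k)
    where
    ring : ∀ a b → a + b + 0 ≡ a + 0 + (b + 0)
    ring = solve-∀
halfLine-last (suc n) (suc u) k
  rewrite halfLine-last n (2 + u) k | halfLine-last n u k = lemma k
  where
  lemma : ∀ k → halfLine n (2 + u) (suc k) + pre (halfLine n (2 + u)) k
              + (halfLine n u (suc k) + pre (halfLine n u) k)
        ≡ halfLine n (2 + u) (suc k) + halfLine n u (suc k) + pre (halfLine (suc n) (suc u)) k
  lemma zero    = ring (halfLine n (2 + u) 1) (halfLine n u 1)
    where
    ring : ∀ a b → a + 0 + (b + 0) ≡ a + b + 0
    ring = solve-∀
  lemma (suc k) = ring (halfLine n (2 + u) (2 + k)) (halfLine n (2 + u) k) (halfLine n u (2 + k)) (halfLine n u k)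
    where
    ring : ∀ a b c d → a + b + (c + d) ≡ a + c + (b + d)
    ring = solve-∀

Σ< : ℕ → (ℕ → ℕ) → ℕ
Σ< zero    f = 0
Σ< (suc K) f = Σ< K f + f K

Σ<-cong : ∀ K {f g} → (∀ k → f k ≡ g k) → Σ< K f ≡ Σ< K g
Σ<-cong zero    eq = refl
Σ<-cong (suc K) eq = cong₂ _+_ (Σ<-cong K eq) (eq K)

Σ<-zero : ∀ K {f} → (∀ k → k < K → f k ≡ 0) → Σ< K f ≡ 0
Σ<-zero zero    eq = refl
Σ<-zero (suc K) eq = cong₂ _+_ (Σ<-zero K λ k k<K → eq k (m≤n⇒m≤1+n k<K)) (eq K ≤-refl)

Σ<-+ : ∀ K f g → Σ< K (λ k → f k + g k) ≡ Σ< K f + Σ< K g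
Σ<-+ zero    f g = refl
Σ<-+ (suc K) f g rewrite Σ<-+ K f g = ring (Σ< K f) (Σ< K g) (f K) (g K)
  where
  ring : ∀ a b c d → a + b + (c + d) ≡ a + c + (b + d)
  ring = solve-∀

-- The arguments `2 + k` and `k` are x + y + 2 and x - y at an endpoint (x, 0) of a GB walk.
pairing : ℕ → (f g : ℕ → ℕ) → ℕ
pairing K f g = Σ< K λ k → f (2 + k) * g k

module _ (K : ℕ) where

  endpoints : ℕ → ℕ → ℕ → ℕ
  endpoints n u v = pairing K (halfLine n u) (halfLine n v)

  -- Both walkers move at once, so the product of their first-step recursions expands into four
  -- terms, one for each GB step.
  endpoints-step : ∀ n u v → endpoints (suc n) u v
         ≡ endpoints n (suc u) (suc v) + pre (λ u → endpoints n u (suc v)) u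
         + pre (λ v → endpoints n (suc u) v + pre (λ u → endpoints n u v) u) v
  endpoints-step n zero zero =
    trans (Σ<-cong K λ k → ring (halfLine n 1 (2 + k)) (halfLine n 1 k))
          (ring′ (endpoints n 1 1))
    where
    ring : ∀ a b → (a + 0) * (b + 0) ≡ a * b
    ring = solve-∀
    ring′ : ∀ a → a ≡ a + 0 + 0
    ring′ = solve-∀
  endpoints-step n zero (suc v) =
    trans (Σ<-cong K λ k → ring (halfLine n 1 (2 + k)) (halfLine n (2 + v) k) (halfLine n v k))
   (trans (Σ<-+ K _ _) (ring′ (endpoints n 1 (2 + v)) (endpoints n 1 v)))
    where
    ring : ∀ a b c → (a + 0) * (b + c) ≡ a * b + a * c
    ring = solve-∀
    ring′ : ∀ a b → a + b ≡ a + 0 + (b + 0)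
    ring′ = solve-∀
  endpoints-step n (suc u) zero =
    trans (Σ<-cong K λ k → ring (halfLine n (2 + u) (2 + k)) (halfLine n u (2 + k)) (halfLine n 1 k))
   (trans (Σ<-+ K _ _) (ring′ (endpoints n (2 + u) 1) (endpoints n u 1)))
    where
    ring : ∀ a b c → (a + b) * (c + 0) ≡ a * c + b * c
    ring = solve-∀
    ring′ : ∀ a b → a + b ≡ a + b + 0
    ring′ = solve-∀
  endpoints-step n (suc u) (suc v) =
    trans (Σ<-cong K λ k → ring (halfLine n (2 + u) (2 + k)) (halfLine n u (2 + k))
                             (halfLine n (2 + v) k) (halfLine n v k))
   (trans (Σ<-+ K _ _) (cong₂ _+_ (Σ<-+ K _ _) (Σ<-+ K _ _)))
    where
    ring : ∀ a b c d → (a + b) * (c + d) ≡ (a * c + b * c) + (a * d + b * d)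
    ring = solve-∀

δ-refl : ∀ u → δ u u ≡ 1
δ-refl zero    = refl
δ-refl (suc u) = δ-refl u

δ-< : ∀ {u k} → u < k → δ u k ≡ 0
δ-< {zero}  {suc k} _         = refl
δ-< {suc u} {suc k} (s≤s u<k) = δ-< u<k

δ-> : ∀ {u k} → k < u → δ u k ≡ 0
δ-> {suc u} {zero}  _         = refl
δ-> {suc u} {suc k} (s≤s k<u) = δ-> k<u

-- The exchanged endpoints would force u = v - 2, whereas u exceeds v by at least 2.
δ-collision : ∀ u v y k → u ≡ v + (2 + 2 * y) → δ v (2 + k) * δ u k ≡ 0
δ-collision u v y k refl with <-≤-connex k (v + (2 + 2 * y))
... | inj₁ k<u = trans (cong (δ v (2 + k) *_) (δ-> k<u)) (*-zeroʳ (δ v (2 + k)))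
... | inj₂ u≤k = cong (_* δ (v + (2 + 2 * y)) k)
  (δ-< {v} {2 + k} (s≤s (≤-trans (≤-trans (m≤m+n v (2 + 2 * y)) u≤k) (n≤1+n k))))

Σ<-δ : ∀ K v (f : ℕ → ℕ) → v < K → Σ< K (λ k → f k * δ v k) ≡ f v
Σ<-δ (suc K) v f (s≤s v≤K) with m≤n⇒m<n∨m≡n v≤K
... | inj₁ v<K rewrite Σ<-δ K v f v<K | δ-< v<K | *-zeroʳ (f K) = +-identityʳ (f v)
... | inj₂ refl rewrite Σ<-zero K {λ k → f k * δ v k} (λ k k<K → trans (cong (f k *_) (δ-> k<K)) (*-zeroʳ (f k)))
    | δ-refl v = *-identityʳ (f v)

-- Karlin–McGregor: endpoints K n u v − endpoints K n v u counts the pairs of simultaneous half-line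
-- walks from u and v that never meet and end at distance 2, and x + y + 2 and x − y move as such
-- a pair along a GB walk. K only has to exceed every height the lower walk can reach.
gb-det : ∀ K n v y u → v + n < K → u ≡ v + (2 + 2 * y) →
         gb (const 1) n v y + endpoints K n v u ≡ endpoints K n u v
gb-det K zero v y u v<K refl = trans
  (cong (λ t → gb (const 1) 0 v y + t) (Σ<-zero K λ k _ → δ-collision u v y k refl))
  (trans (base y) (sym (Σ<-δ K v (λ k → δ u (2 + k)) (subst (_< K) (+-identityʳ v) v<K))))
  where
  -- The surviving summand k = v is 1 exactly when u = v + 2, that is when y = 0.
  base : ∀ y → gb (const 1) 0 v y + 0 ≡ δ (v + (2 + 2 * y)) (2 + v)
  base zero    = sym (trans (cong (λ u → δ u (2 + v)) (+-comm v 2)) (δ-refl v))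
  base (suc y) = sym (δ-> (subst (_< v + (2 + 2 * suc y)) (+-comm v 2)
                     (+-monoʳ-< v (s≤s (s≤s (s≤s z≤n))))))
gb-det K (suc n) v y zero v<K eq with () ← trans eq (+-suc v (suc (2 * y)))
gb-det K (suc n) v y (suc u) v<K eq
  rewrite endpoints-step K n v (suc u) | endpoints-step K n (suc u) v = main v y v<K eq
  where
  higher : ∀ v y → suc (suc (v + (2 + 2 * y))) ≡ v + (2 + 2 * suc y)
  higher = solve-∀
  main : ∀ v y → v + suc n < K → suc u ≡ v + (2 + 2 * y) →
         gb (const 1) (suc n) v y
         + (endpoints K n (suc v) (suc (suc u)) + pre (λ v → endpoints K n v (suc (suc u))) v
            + (endpoints K n (suc v) u + pre (λ v → endpoints K n v u) v))
       ≡ endpoints K n (suc (suc u)) (suc v) + endpoints K n u (suc v)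
         + pre (λ v → endpoints K n (suc (suc u)) v + endpoints K n u v) v
  main v y v<K eq = finish v y v<K eq
    (gb-det K n (suc v) y (suc (suc u)) (subst (_< K) (+-suc v n) v<K) (cong suc eq))
    (south y eq)
    where
    south : ∀ y → suc u ≡ v + (2 + 2 * y) → pre (gb (const 1) n (suc v)) y + endpoints K n (suc v) u ≡ endpoints K n u (suc v)
    -- From y = 0 a south step makes the walkers meet at `suc v`, and there the determinant vanishes
    -- by symmetry.
    south zero    eq with refl ← suc-injective (trans eq (+-comm v 2)) = refl
    south (suc y) eq = gb-det K n (suc v) y u (subst (_< K) (+-suc v n) v<K)
      (suc-injective (trans eq (sym (higher v y))))
    v+n<K : ∀ {v} → suc v + suc n < K → v + n < K
    v+n<K {v} = ≤-trans (s≤s (+-mono-≤ (n≤1+n v) (n≤1+n n)))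
    finish : ∀ v y → v + suc n < K → suc u ≡ v + (2 + 2 * y) →
         gb (const 1) n (suc v) y + endpoints K n (suc v) (suc (suc u)) ≡ endpoints K n (suc (suc u)) (suc v) →
         pre (gb (const 1) n (suc v)) y + endpoints K n (suc v) u ≡ endpoints K n u (suc v) →
         gb (const 1) (suc n) v y
         + (endpoints K n (suc v) (suc (suc u)) + pre (λ v → endpoints K n v (suc (suc u))) v
            + (endpoints K n (suc v) u + pre (λ v → endpoints K n v u) v))
       ≡ endpoints K n (suc (suc u)) (suc v) + endpoints K n u (suc v)
         + pre (λ v → endpoints K n (suc (suc u)) v + endpoints K n u v) v
    finish zero y _ _ e s rewrite sym e | sym s =
      ring (gb (const 1) n 1 y) (pre (gb (const 1) n 1) y) (endpoints K n 1 (suc (suc u))) (endpoints K n 1 u)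
      where
      ring : ∀ a b c d → a + b + 0 + (c + 0 + (d + 0)) ≡ a + c + (b + d) + 0
      ring = solve-∀
    finish (suc v) y v<K eq e s
      -- `e` and `s` are the induction hypotheses for east and south; the two calls of `gb-det`
      -- below are those for west and north.
      rewrite sym e | sym s
      | sym (gb-det K n v y u (v+n<K v<K) (suc-injective eq))
      | sym (gb-det K n v (suc y) (suc (suc u)) (v+n<K v<K)
              (trans (cong suc eq) (higher v y)))
      = ring (gb (const 1) n (2 + v) y) (pre (gb (const 1) n (2 + v)) y) (gb (const 1) n v y) (gb (const 1) n v (suc y))
          (endpoints K n (2 + v) (suc (suc u))) (endpoints K n v (suc (suc u))) (endpoints K n (2 + v) u) (endpoints K n v u)
      where
      ring : ∀ a b c d p q s t → a + b + (c + d) + (p + q + (s + t)) ≡ a + p + (b + s) + (d + q + (c + t))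
      ring = solve-∀

-- Telescoping the determinant for walks from the origin

halfLine-vanish : ∀ n {u k} → u + n < k → halfLine n u k ≡ 0
halfLine-vanish zero    {u}     {k} lt = δ-< (subst (_< k) (+-identityʳ u) lt)
halfLine-vanish (suc n) {zero}  {k} lt rewrite halfLine-vanish n {1} {k} lt = refl
halfLine-vanish (suc n) {suc u} {k} lt
  rewrite halfLine-vanish n {2 + u} {k} (subst (_< k) (cong suc (+-suc u n)) lt)
        | halfLine-vanish n {u} {k} (≤-trans (s≤s (+-mono-≤ (n≤1+n u) (n≤1+n n))) lt) = refl

module _ (n : ℕ) where

  private
    p p⁺ : ℕ → ℕ
    p = halfLine n 0
    p⁺ = halfLine (2 + n) 0

  p⁺-step₀ : p⁺ 0 ≡ p 2 + p 0
  p⁺-step₀ rewrite halfLine-last (suc n) 0 0 | halfLine-last n 0 1 = +-identityʳ _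

  p⁺-step₁ : p⁺ 1 ≡ p 3 + p 1 + p 1
  p⁺-step₁ rewrite halfLine-last (suc n) 0 1 | halfLine-last n 0 2 | halfLine-last n 0 0 =
    cong (λ t → p 3 + p 1 + t) (+-identityʳ (p 1))

  p⁺-step : ∀ k → p⁺ (2 + k) ≡ p (4 + k) + p (2 + k) + (p (2 + k) + p k)
  p⁺-step k rewrite halfLine-last (suc n) 0 (2 + k) | halfLine-last n 0 (3 + k) | halfLine-last n 0 (1 + k) = refl

  -- For k ≥ 2, `p⁺-step` gives p⁺(k+2) p(k) - p(k+2) p⁺(k) = a(k) - a(k-2) with a(k) = p(k+4) p(k)
  -- - p(k+2)². Hence only the last two values of a survive, and k = 0, 1 contribute the constant.
  -- Negative terms stand on the opposite side.
  telescope : ∀ K → pairing (2 + K) p⁺ p + (p (2 + K) * p (2 + K) + p (3 + K) * p (3 + K))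
            ≡ pairing (2 + K) p p⁺ + (p 0 * p 0 + p 1 * p 1 + p 0 * p 2)
              + (p (5 + K) * p (1 + K) + p (4 + K) * p K)
  telescope zero rewrite p⁺-step 0 | p⁺-step 1 | p⁺-step₀ | p⁺-step₁ = ring (p 0) (p 1) (p 2) (p 3) (p 4) (p 5)
    where
    ring : ∀ p₀ p₁ p₂ p₃ p₄ p₅ →
      (p₄ + p₂ + (p₂ + p₀)) * p₀ + (p₅ + p₃ + (p₃ + p₁)) * p₁ + (p₂ * p₂ + p₃ * p₃)
      ≡ p₂ * (p₂ + p₀) + p₃ * (p₃ + p₁ + p₁) + (p₀ * p₀ + p₁ * p₁ + p₀ * p₂) + (p₅ * p₁ + p₄ * p₀)
    ring = solve-∀
  telescope (suc K) =
    step (pairing (2 + K) p⁺ p) (pairing (2 + K) p p⁺) (p 0 * p 0 + p 1 * p 1 + p 0 * p 2)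
         (p K) (p (1 + K)) (p (2 + K)) (p (3 + K)) (p (4 + K)) (p (5 + K)) (p (6 + K))
         (p⁺-step K) (p⁺-step (2 + K)) (telescope K)
    where
    step : ∀ S₁ S₂ c p₀ p₁ p₂ p₃ p₄ p₅ p₆ {r₂ r₄} →
      r₂ ≡ p₄ + p₂ + (p₂ + p₀) → r₄ ≡ p₆ + p₄ + (p₄ + p₂) →
      S₁ + (p₂ * p₂ + p₃ * p₃) ≡ S₂ + c + (p₅ * p₁ + p₄ * p₀) →
      S₁ + r₄ * p₂ + (p₃ * p₃ + p₄ * p₄) ≡ S₂ + p₄ * r₂ + c + (p₆ * p₂ + p₅ * p₁)
    step S₁ S₂ c p₀ p₁ p₂ p₃ p₄ p₅ p₆ refl refl eq =
      trans (left S₁ p₂ p₃ p₄ p₆) (trans (cong (_+ (p₆ * p₂ + 2 * (p₄ * p₂) + p₄ * p₄)) eq) (right S₂ c p₀ p₁ p₂ p₄ p₅ p₆))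
      where
      left : ∀ S p₂ p₃ p₄ p₆ →
        S + (p₆ + p₄ + (p₄ + p₂)) * p₂ + (p₃ * p₃ + p₄ * p₄)
        ≡ S + (p₂ * p₂ + p₃ * p₃) + (p₆ * p₂ + 2 * (p₄ * p₂) + p₄ * p₄)
      left = solve-∀
      right : ∀ S c p₀ p₁ p₂ p₄ p₅ p₆ →
        S + c + (p₅ * p₁ + p₄ * p₀) + (p₆ * p₂ + 2 * (p₄ * p₂) + p₄ * p₄)
        ≡ S + p₄ * (p₄ + p₂ + (p₂ + p₀)) + c + (p₆ * p₂ + p₅ * p₁)
      right = solve-∀

  -- With `3 + n` summands every product left at the upper end has a factor p(k) with k > n, out of
  -- reach of n steps.
  pairing-cut : pairing (3 + n) p⁺ p ≡ pairing (3 + n) p p⁺ + (p 0 * p 0 + p 1 * p 1 + p 0 * p 2)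
  pairing-cut = +-cancelʳ-≡ 0 _ _ (subst₂ (λ a b → pairing (3 + n) p⁺ p + a ≡ pairing (3 + n) p p⁺ + (p 0 * p 0 + p 1 * p 1 + p 0 * p 2) + b) zeroˡ zeroʳ (telescope (suc n)))
    where
    zeroˡ : p (3 + n) * p (3 + n) + p (4 + n) * p (4 + n) ≡ 0
    zeroˡ rewrite halfLine-vanish n {0} {3 + n} (m≤n+m _ 2) | halfLine-vanish n {0} {4 + n} (m≤n+m _ 3) = refl
    zeroʳ : p (6 + n) * p (2 + n) + p (5 + n) * p (1 + n) ≡ 0
    zeroʳ rewrite halfLine-vanish n {0} {6 + n} (m≤n+m _ 5) | halfLine-vanish n {0} {5 + n} (m≤n+m _ 4) = refl

  -- Two first steps from 0 lead to 2 or back to 0, so p⁺ is `halfLine n 2` plus p. Substituting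
  -- this adds the same `pairing (3 + n) p p` to both halves of the determinant at u = 2, v = 0,
  -- which turns it into the telescoping difference.
  gb-total : gb (const 1) n 0 0 ≡ p 0 * p 0 + p 1 * p 1 + p 0 * p 2
  gb-total = +-cancelʳ-≡ (pairing (3 + n) p p⁺) _ _ (begin
    gb (const 1) n 0 0 + pairing (3 + n) p p⁺                 ≡⟨ cong (λ t → gb (const 1) n 0 0 + t) splitʳ ⟩
    gb (const 1) n 0 0 + (endpoints (3 + n) n 0 2 + pairing (3 + n) p p) ≡⟨ sym (+-assoc (gb (const 1) n 0 0) _ _) ⟩
    gb (const 1) n 0 0 + endpoints (3 + n) n 0 2 + pairing (3 + n) p p
      ≡⟨ cong (_+ pairing (3 + n) p p) (gb-det (3 + n) n 0 0 2 (m≤n+m _ 2) refl) ⟩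
    endpoints (3 + n) n 2 0 + pairing (3 + n) p p                 ≡⟨ sym splitˡ ⟩
    pairing (3 + n) p⁺ p                                   ≡⟨ pairing-cut ⟩
    pairing (3 + n) p p⁺ + (p 0 * p 0 + p 1 * p 1 + p 0 * p 2) ≡⟨ +-comm (pairing (3 + n) p p⁺) _ ⟩
    p 0 * p 0 + p 1 * p 1 + p 0 * p 2 + pairing (3 + n) p p⁺ ∎)
    where
    open ≡-Reasoning
    splitʳ : pairing (3 + n) p p⁺ ≡ endpoints (3 + n) n 0 2 + pairing (3 + n) p p
    splitʳ = trans (Σ<-cong (3 + n) λ k → ring (p (2 + k)) (halfLine n 2 k) (p k)) (Σ<-+ (3 + n) _ _)
      where
      ring : ∀ a b c → a * (b + c + 0) ≡ a * b + a * c
      ring = solve-∀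
    splitˡ : pairing (3 + n) p⁺ p ≡ endpoints (3 + n) n 2 0 + pairing (3 + n) p p
    splitˡ = trans (Σ<-cong (3 + n) λ k → ring (halfLine n 2 (2 + k)) (p (2 + k)) (p k)) (Σ<-+ (3 + n) _ _)
      where
      ring : ∀ a b c → (a + b + 0) * c ≡ a * c + b * c
      ring = solve-∀

-- Half-line walks and Catalan numbers

pascal : ∀ n k → suc n C k ≡ pre (n C_) k + n C k
pascal n zero    = refl
pascal n (suc k) = sym (nCk+nC[k+1]≡[n+1]C[k+1] n k)

central-symmetry : ∀ a → (a + suc a) C suc a ≡ (a + suc a) C a
central-symmetry a = trans (nCk≡nC[n∸k] (m≤n+m (suc a) a)) (cong ((a + suc a) C_) (m+n∸n≡m a (suc a)))

-- André's reflection: a steps go down and k + a go up.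
halfLine-ballot : ∀ n a k → n ≡ a + (k + a) → halfLine n 0 k + pre (n C_) a ≡ n C a
halfLine-ballot zero    zero    zero    eq = refl
halfLine-ballot (suc n) zero    (suc k) eq
  rewrite halfLine-last n 0 (suc k)
        | halfLine-vanish n {0} {2 + k} (s≤s (subst (_≤ suc k) (sym (trans (suc-injective eq) (+-identityʳ k))) (n≤1+n k)))
  = halfLine-ballot n zero k (suc-injective eq)
halfLine-ballot (suc n) (suc a) zero    eq = begin
  halfLine (suc n) 0 0 + suc n C a         ≡⟨ cong₂ _+_ (halfLine-last n 0 0) (pascal n a) ⟩
  halfLine n 0 1 + 0 + (pre (n C_) a + n C a) ≡⟨ ring (halfLine n 0 1) _ (n C a) ⟩
  halfLine n 0 1 + pre (n C_) a + n C a
    ≡⟨ cong₂ _+_ (halfLine-ballot n a 1 (suc-injective eq)) (sym symmetry) ⟩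
  n C a + n C suc a                        ≡⟨ sym (pascal n (suc a)) ⟩
  suc n C suc a                            ∎
  where
  open ≡-Reasoning
  ring : ∀ x y z → x + 0 + (y + z) ≡ x + y + z
  ring = solve-∀
  -- The reflection formula at height -1, `n C suc a` minus `n C a`, vanishes because n = 2a + 1; so
  -- the blocked position contributes nothing.
  symmetry : n C suc a ≡ n C a
  symmetry = subst (λ n → n C suc a ≡ n C a) (sym (suc-injective eq)) (central-symmetry a)
halfLine-ballot (suc n) (suc a) (suc k) eq = begin
  halfLine (suc n) 0 (suc k) + suc n C a   ≡⟨ cong₂ _+_ (halfLine-last n 0 (suc k)) (pascal n a) ⟩
  halfLine n 0 (2 + k) + halfLine n 0 k + (pre (n C_) a + n C a)
    ≡⟨ ring (halfLine n 0 (2 + k)) (halfLine n 0 k) _ _ ⟩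
  (halfLine n 0 (2 + k) + pre (n C_) a) + (halfLine n 0 k + n C a)
    ≡⟨ cong₂ _+_ (halfLine-ballot n a (2 + k) (trans (suc-injective eq) (ring₁ a k)))
                 (halfLine-ballot n (suc a) k (trans (suc-injective eq) (ring₂ a k))) ⟩
  n C a + n C suc a                        ≡⟨ sym (pascal n (suc a)) ⟩
  suc n C suc a                            ∎
  where
  open ≡-Reasoning
  ring : ∀ x y z w → x + y + (z + w) ≡ x + z + (y + w)
  ring = solve-∀
  ring₁ : ∀ a k → a + (suc k + suc a) ≡ a + (2 + k + a)
  ring₁ = solve-∀
  ring₂ : ∀ a k → a + (suc k + suc a) ≡ suc a + (k + suc a)
  ring₂ = solve-∀

-- Reflection gives P + C(2m, m-1) = C(2m, m). Multiplying by m + 1 and using (m+1) C(2m, m-1) = m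
-- C(2m, m), which is `below`, leaves (m+1) P = C(2m, m).
halfLine-catalan : ∀ m → halfLine (2 * m) 0 0 ≡ catalan m
halfLine-catalan m = sym (trans (cong (_/ suc m) (sym (+-cancelʳ-≡ (m * c) _ _ scaled))) (m*n/n≡m P (suc m)))
  where
  c = (2 * m) C m
  P = halfLine (2 * m) 0 0
  below : ∀ m → suc m * pre ((2 * m) C_) m ≡ m * ((2 * m) C m)
  below zero    = refl
  below (suc m) = +-cancelʳ-≡ (m * c₋) _ _ (sym (trans (binomial-ratio (2 * suc m) m) (ring m c₋)))
    where
    c₋ = (2 * suc m) C m
    ring : ∀ m c → (2 * suc m) * c ≡ suc (suc m) * c + m * c
    ring = solve-∀
  scaled : P * suc m + m * c ≡ c + m * c
  scaled = trans (cong (λ t → P * suc m + t) (sym (below m)))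
    (trans (ring P m (pre ((2 * m) C_) m))
      (cong (suc m *_) (halfLine-ballot (2 * m) m 0 (cong (λ t → m + t) (+-identityʳ m)))))
    where
    ring : ∀ P m q → P * suc m + suc m * q ≡ suc m * (P + q)
    ring = solve-∀

halfLine-odd : ∀ n m k → n + k ≡ suc (2 * m) → halfLine n 0 k ≡ 0
halfLine-odd zero    m       (suc k) eq = refl
halfLine-odd (suc n) m       zero    eq rewrite halfLine-last n 0 0
  | halfLine-odd n m 1 (trans (+-suc n 0) eq) = refl
halfLine-odd (suc n) zero    (suc k) eq with () ← trans (sym (+-suc n k)) (suc-injective eq)
halfLine-odd (suc n) (suc m) (suc k) eq rewrite halfLine-last n 0 (suc k)
  | halfLine-odd n (suc m) (2 + k) (trans (+-suc n (suc k)) eq)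
  | halfLine-odd n m k (suc-injective (suc-injective (trans (cong suc (sym (+-suc n k)))
      (trans eq (cong suc (cong suc (+-suc m (m + 0)))))))) = refl

double/2 : ∀ m → (2 * m) / 2 ≡ m
double/2 m = trans (cong (_/ 2) (*-comm 2 m)) (m*n/n≡m m 2)

suc-double/2 : ∀ m → suc (2 * m) / 2 ≡ m
suc-double/2 zero    = refl
suc-double/2 (suc m) = trans (cong (_/ 2) (ring m))
  (trans (m/n≡1+[m∸n]/n {3 + 2 * m} {2} (s≤s (s≤s z≤n))) (cong suc (suc-double/2 m)))
  where
  ring : ∀ m → suc (2 * suc m) ≡ 3 + 2 * m
  ring = solve-∀

even-or-odd : ∀ n → (∃[ m ] n ≡ 2 * m) ⊎ (∃[ m ] n ≡ suc (2 * m))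
even-or-odd zero    = inj₁ (0 , refl)
even-or-odd (suc n) with even-or-odd n
... | inj₁ (m , refl) = inj₂ (m , refl)
... | inj₂ (m , refl) = inj₁ (suc m , cong suc (sym (+-suc m (m + 0))))

gb-catalan : ∀ n → gb (const 1) n 0 0 ≡ catalan (suc n / 2) * catalan ((suc n + 1) / 2)
gb-catalan n with even-or-odd n
... | inj₁ (m , refl) = begin
  gb (const 1) n 0 0                          ≡⟨ gb-total n ⟩
  p 0 * p 0 + p 1 * p 1 + p 0 * p 2
    ≡⟨ cong (λ z → p 0 * p 0 + z * p 1 + p 0 * p 2) (halfLine-odd n m 1 (+-comm n 1)) ⟩
  p 0 * p 0 + 0 + p 0 * p 2                ≡⟨ ring (p 0) (p 2) ⟩
  -- Two further steps lead back to 0 in one way from 2 and in one way from 0, so the bracket counts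
  -- returns of length n + 2.
  p 0 * (p 2 + p 0)                        ≡⟨ cong (p 0 *_) (sym (p⁺-step₀ n)) ⟩
  p 0 * halfLine (2 + n) 0 0
    ≡⟨ cong₂ _*_ (halfLine-catalan m)
                 (trans (cong (λ n → halfLine n 0 0) (double m)) (halfLine-catalan (suc m))) ⟩
  catalan m * catalan (suc m)
    ≡⟨ cong₂ (λ a b → catalan a * catalan b) (sym (suc-double/2 m))
         (sym (trans (cong (_/ 2) (double′ m)) (double/2 (suc m)))) ⟩
  catalan (suc n / 2) * catalan ((suc n + 1) / 2) ∎
  where
  open ≡-Reasoning
  p = halfLine n 0
  ring : ∀ a b → a * a + 0 + a * b ≡ a * (b + a)
  ring = solve-∀
  double : ∀ m → 2 + 2 * m ≡ 2 * suc m
  double = solve-∀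
  double′ : ∀ m → suc (2 * m) + 1 ≡ 2 * suc m
  double′ = solve-∀
... | inj₂ (m , refl) = begin
  gb (const 1) n 0 0                          ≡⟨ gb-total n ⟩
  p 0 * p 0 + p 1 * p 1 + p 0 * p 2
    ≡⟨ cong (λ z → z * z + p 1 * p 1 + z * p 2) (halfLine-odd n m 0 (+-identityʳ n)) ⟩
  p 1 * p 1 + 0                            ≡⟨ +-identityʳ (p 1 * p 1) ⟩
  p 1 * p 1                                ≡⟨ cong (λ z → z * z) return ⟩
  catalan (suc m) * catalan (suc m)
    ≡⟨ cong₂ (λ a b → catalan a * catalan b)
         (sym (trans (cong (_/ 2) (double m)) (double/2 (suc m))))
         (sym (trans (cong (_/ 2) (double′ m)) (suc-double/2 (suc m)))) ⟩
  catalan (suc n / 2) * catalan ((suc n + 1) / 2) ∎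
  where
  open ≡-Reasoning
  p = halfLine n 0
  double : ∀ m → suc (suc (2 * m)) ≡ 2 * suc m
  double = solve-∀
  double′ : ∀ m → suc (suc (2 * m)) + 1 ≡ suc (2 * suc m)
  double′ = solve-∀
  -- The last step of a return of length n + 1 comes from height 1.
  return : p 1 ≡ catalan (suc m)
  return = trans (sym (+-identityʳ (p 1))) (trans (sym (halfLine-last n 0 0))
    (trans (cong (λ n → halfLine n 0 0) (double m)) (halfLine-catalan (suc m))))

-- Enumeration of walks and permutations

⟦_⟧ : {P : Set ℓ₁} → Dec P → ℕ
⟦ P? ⟧ = if does P? then 1 else 0

-- Tying a proposition to a number instead of a decision lets products such as `site c v * good c`
-- act as characteristic functions; `indicates-unique` then equates them with the decided `⟦_⟧`.
data Indicates (P : Set ℓ) : ℕ → Set ℓ where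
  holds : P → Indicates P 1
  fails : ¬ P → Indicates P 0

⟦⟧-indicates : {P : Set ℓ₁} (P? : Dec P) → Indicates P ⟦ P? ⟧
⟦⟧-indicates (yes pf) = holds pf
⟦⟧-indicates (no ¬pf) = fails ¬pf

indicates-unique : ∀ {P : Set ℓ} {m n} → Indicates P m → Indicates P n → m ≡ n
indicates-unique (holds _)  (holds _)  = refl
indicates-unique (holds pf) (fails ¬p) = contradiction pf ¬p
indicates-unique (fails ¬p) (holds pf) = contradiction pf ¬p
indicates-unique (fails _)  (fails _)  = refl

indicates-map : ∀ {P : Set ℓ₁} {Q : Set ℓ₂} {m} → (P → Q) → (Q → P) → Indicates P m → Indicates Q m
indicates-map to from (holds pf) = holds (to pf)
indicates-map to from (fails ¬p) = fails (¬p ∘ from)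

indicates-× : ∀ {P : Set ℓ₁} {Q : Set ℓ₂} {m n} → Indicates P m → Indicates Q n → Indicates (P × Q) (m * n)
indicates-× (holds pf) (holds qf) = holds (pf , qf)
indicates-× (holds _)  (fails ¬q) = fails (¬q ∘ proj₂)
indicates-× (fails ¬p) _          = fails (¬p ∘ proj₁)

total : (A → ℕ) → List A → ℕ
total f xs = sum (List.map f xs)

total-cong : ∀ {f g : A → ℕ} → (∀ x → f x ≡ g x) → ∀ xs → total f xs ≡ total g xs
total-cong eq xs = cong sum (List.map-cong eq xs)

total-zero : ∀ {f : A → ℕ} → (∀ x → f x ≡ 0) → ∀ xs → total f xs ≡ 0
total-zero eq []       = refl
total-zero eq (x ∷ xs) = cong₂ _+_ (eq x) (total-zero eq xs)

total-+ : ∀ (f g : A → ℕ) xs → total (λ x → f x + g x) xs ≡ total f xs + total g xs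
total-+ f g []       = refl
total-+ f g (x ∷ xs) = trans (cong (λ t → f x + g x + t) (total-+ f g xs)) (ring (f x) (g x) _ _)
  where
  ring : ∀ a b c d → a + b + (c + d) ≡ a + c + (b + d)
  ring = solve-∀

total-* : ∀ k (f : A → ℕ) xs → total (λ x → k * f x) xs ≡ k * total f xs
total-* k f []       = sym (*-zeroʳ k)
total-* k f (x ∷ xs) = trans (cong (λ t → k * f x + t) (total-* k f xs)) (sym (*-distribˡ-+ k (f x) _))

total-cartesianProductWith : ∀ (g : D → ℕ) (f : A → B → D) xs ys →
  total g (cartesianProductWith f xs ys) ≡ total (λ x → total (g ∘ f x) ys) xs
total-cartesianProductWith g f []       ys = refl
total-cartesianProductWith g f (x ∷ xs) ys = begin
  sum (List.map g (List.map (f x) ys List.++ cartesianProductWith f xs ys))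
    ≡⟨ cong sum (List.map-++ g (List.map (f x) ys) _) ⟩
  sum (List.map g (List.map (f x) ys) List.++ List.map g (cartesianProductWith f xs ys))
    ≡⟨ sum-++ (List.map g (List.map (f x) ys)) _ ⟩
  total g (List.map (f x) ys) + total g (cartesianProductWith f xs ys)
    ≡⟨ cong₂ _+_ (cong sum (sym (List.map-∘ ys))) (total-cartesianProductWith g f xs ys) ⟩
  total (g ∘ f x) ys + total (λ x → total (g ∘ f x) ys) xs ∎
  where open ≡-Reasoning

count-total : ∀ {P : Pred A ℓ} (P? : Decidable P) xs → count P? xs ≡ total (λ x → ⟦ P? x ⟧) xs
count-total P? []       = refl
count-total P? (x ∷ xs) with does (P? x)
... | true  = cong suc (count-total P? xs)
... | false = count-total P? xs

-- Lattice walks in the wedge and the recursion `gb`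

wedge-head : ∀ {p} (w : Vec ℤ² n) → All InWedge (path p w) → InWedge p
wedge-head []      (i ∷ _) = i
wedge-head (_ ∷ _) (i ∷ _) = i

WalkFrom : ℤ² → ℕ → Vec ℤ² n → Set
WalkFrom p b w = All InWedge (path p w) × last (path p w) ≡ (+ b , 0ℤ)

walkFrom? : ∀ p b → Decidable (WalkFrom {n} p b)
walkFrom? p b w = All.all? inWedge? (path p w) ×-dec (last (path p w) ≟² (+ b , 0ℤ))

walks : ℕ → ℤ² → ℕ → ℕ
walks n p b = total (λ w → ⟦ walkFrom? p b w ⟧) (words gbSteps n)

walks-outside : ∀ n {p} b → ¬ InWedge p → walks n p b ≡ 0
walks-outside n b p∉ = total-zero
  (λ w → indicates-unique (⟦⟧-indicates (walkFrom? _ b w)) (fails (p∉ ∘ wedge-head w ∘ proj₁)))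
  (words gbSteps n)

walks-step : ∀ n {x y} b → InWedge (x , y) → walks (suc n) (x , y) b ≡
  total (λ (dx , dy) → walks n (x ℤ.+ dx , y ℤ.+ dy) b) gbSteps
walks-step n {x} {y} b p∈ = trans (total-cartesianProductWith _ _∷_ gbSteps (words gbSteps n))
  (total-cong (λ s → total-cong (λ w → indicates-unique (⟦⟧-indicates (walkFrom? (x , y) b (s ∷ w)))
    (indicates-map (extend s w) (restrict s w) (⟦⟧-indicates (walkFrom? _ b w)))) (words gbSteps n)) gbSteps)
  where
  extend : ∀ ((dx , dy) : ℤ²) w → WalkFrom (x ℤ.+ dx , y ℤ.+ dy) b w → WalkFrom (x , y) b ((dx , dy) ∷ w)
  extend s w (ins , end) = p∈ ∷ ins , end
  restrict : ∀ ((dx , dy) : ℤ²) w → WalkFrom (x , y) b ((dx , dy) ∷ w) → WalkFrom (x ℤ.+ dx , y ℤ.+ dy) b w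
  restrict s w (_ ∷ ins , end) = ins , end

δ-indicates : ∀ b v → Indicates (v ≡ b) (δ b v)
δ-indicates zero    zero    = holds refl
δ-indicates zero    (suc v) = fails λ ()
δ-indicates (suc b) zero    = fails λ ()
δ-indicates (suc b) (suc v) = indicates-map (cong suc) suc-injective (δ-indicates b v)

inWedge : ∀ v y → InWedge (+ (v + y) , + y)
inWedge v y = ℤ.+≤+ z≤n , ℤ.+≤+ z≤n , ℤ.+≤+ (m≤n+m y v)

walks-gb : ∀ n v y b → walks n (+ (v + y) , + y) b ≡ gb (δ b) n v y
walks-gb zero v y b = trans (+-identityʳ _) (indicates-unique (⟦⟧-indicates (walkFrom? (+ (v + y) , + y) b [])) (base y))
  where
  base : ∀ y → Indicates (WalkFrom (+ (v + y) , + y) b []) (gb (δ b) 0 v y)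
  base zero    = indicates-map
    (λ v≡b → inWedge v 0 ∷ [] , cong (λ x → (+ x , 0ℤ)) (trans (+-identityʳ v) v≡b))
    (λ (_ , end) → trans (sym (+-identityʳ v)) (ℤ.+-injective (cong proj₁ end)))
    (δ-indicates b v)
  base (suc y) = fails λ { (_ , ()) }
walks-gb (suc n) v y b = trans (walks-step n b (inWedge v y)) (begin
  -- The summands come in the order of `gbSteps`.
  north + (south + (west + (east + 0)))    ≡⟨ ring north south west east ⟩
  east + south + (west + north)            ≡⟨ cong₂ _+_ (cong₂ _+_ east≡ (south≡ y)) (west≡ v) ⟩
  gb (δ b) (suc n) v y                     ∎)
  where
  open ≡-Reasoning
  ring : ∀ n s w e → n + (s + (w + (e + 0))) ≡ e + s + (w + n)
  ring = solve-∀
  north = walks n (+ (v + y + 0) , + (y + 1)) b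
  south = walks n (+ (v + y + 0) , + y ℤ.+ -[1+ 0 ]) b
  west  = walks n (+ (v + y) ℤ.+ -[1+ 0 ] , + (y + 0)) b
  east  = walks n (+ (v + y + 1) , + (y + 0)) b
  at : ∀ {x′} v′ {y y′} → x′ ≡ v′ + y → y′ ≡ y → walks n (+ x′ , + y′) b ≡ gb (δ b) n v′ y
  at v′ refl refl = walks-gb n v′ _ b
  east≡ : east ≡ gb (δ b) n (suc v) y
  east≡ = at (suc v) (+-comm (v + y) 1) (+-identityʳ y)
  south≡ : ∀ y → walks n (+ (v + y + 0) , + y ℤ.+ -[1+ 0 ]) b ≡ pre (gb (δ b) n (suc v)) y
  south≡ zero    = walks-outside n b λ { (_ , () , _) }
  south≡ (suc y) = at (suc v) (trans (+-identityʳ _) (+-suc v y)) refl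
  west≡ : ∀ v → walks n (+ (v + y) ℤ.+ -[1+ 0 ] , + (y + 0)) b + walks n (+ (v + y + 0) , + (y + 1)) b
        ≡ pre (λ v → gb (δ b) n v y + gb (δ b) n v (suc y)) v
  west≡ (suc v) = cong₂ _+_ (at v refl (+-identityʳ y))
    (at v (trans (+-identityʳ _) (sym (+-suc v y))) (+-comm y 1))
  -- v = 0 is the diagonal, where west and north both leave the wedge.
  west≡ zero    = cong₂ _+_ (walks-outside n b (out y))
    (walks-outside n b λ (_ , _ , le) → <⇒≱ (subst₂ _<_ (sym (+-identityʳ y)) (+-comm 1 y) (n<1+n y)) (ℤ.drop‿+≤+ le))
    where
    out : ∀ y → ¬ InWedge (+ y ℤ.+ -[1+ 0 ] , + (y + 0))
    out zero    (() , _)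
    out (suc y) (_ , _ , le) = <⇒≱ (s≤s (m≤m+n y 0)) (ℤ.drop‿+≤+ le)

H-gb : ∀ n h b → H n h b ≡ gb (δ b) n h 0
H-gb n h b = trans (count-total (isGBWalk? h b) (words gbSteps n))
  (trans (cong (λ x → walks n (+ x , 0ℤ) b) (sym (+-identityʳ h))) (walks-gb n h 0 b))

-- Codes of permutations

infixr 5 _◃_

-- A Lehmer code: `v ◃ c` stands for prepending the letter v once `punchIn v` has made room for it.
-- Removing the first letter, and with it the first step of the ballot path, becomes structural
-- recursion.
data Code : ℕ → Set where
  ε   : Code zero
  _◃_ : Fin (suc m) → Code m → Code (suc m)

decode : Code m → Vec (Fin m) m
decode ε       = []
decode (v ◃ c) = v ∷ Vec.map (punchIn v) (decode c)

all-punchIn : ∀ v (σ : Vec (Fin m) k) → All (v ≢_) (Vec.map (punchIn v) σ)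
all-punchIn v []      = []
all-punchIn v (a ∷ σ) = (Fin.punchInᵢ≢i v a ∘ sym) ∷ all-punchIn v σ

decode-unique : (c : Code m) → Unique (decode c)
decode-unique ε       = []
decode-unique (v ◃ c) = all-punchIn v (decode c) ∷ Unique.map⁺ (Fin.punchIn-injective v _ _) (decode-unique c)

map-injective : ∀ {f : A → B} → (∀ {x y} → f x ≡ f y → x ≡ y) →
                {xs ys : Vec A k} → Vec.map f xs ≡ Vec.map f ys → xs ≡ ys
map-injective inj {[]}     {[]}     eq = refl
map-injective inj {x ∷ xs} {y ∷ ys} eq =
  cong₂ _∷_ (inj (Vec.∷-injectiveˡ eq)) (map-injective inj (Vec.∷-injectiveʳ eq))

decode-injective : {c c′ : Code m} → decode c ≡ decode c′ → c ≡ c′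
decode-injective {c = ε}     {ε}      eq = refl
decode-injective {c = v ◃ c} {v′ ◃ c′} eq with refl ← Vec.∷-injectiveˡ eq =
  cong (v ◃_) (decode-injective (map-injective (Fin.punchIn-injective v _ _) (Vec.∷-injectiveʳ eq)))

unpunch : ∀ {v : Fin (suc m)} {τ : Vec (Fin (suc m)) k} → All (v ≢_) τ → ∃[ σ ] Vec.map (punchIn v) σ ≡ τ
unpunch []        = [] , refl
unpunch (v≢ ∷ v∉) with σ , eq ← unpunch v∉ =
  punchOut v≢ ∷ σ , cong₂ _∷_ (Fin.punchIn-punchOut v≢) eq

unique-map⁻ : ∀ {f : A → B} (xs : Vec A k) → Unique (Vec.map f xs) → Unique xs
unique-map⁻ []       []        = []
unique-map⁻ {f = f} (x ∷ xs) (x∉ ∷ xs!) = all⁻ xs x∉ ∷ unique-map⁻ xs xs!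
  where
  all⁻ : ∀ {k} (xs : Vec _ k) → All (f x ≢_) (Vec.map f xs) → All (x ≢_) xs
  all⁻ []       []        = []
  all⁻ (y ∷ ys) (x≢ ∷ x∉) = (x≢ ∘ cong f) ∷ all⁻ ys x∉

decode-surjective : {π : Vec (Fin m) m} → Unique π → ∃[ c ] decode c ≡ π
decode-surjective {π = []} [] = ε , refl
decode-surjective {π = v ∷ τ} (v∉ ∷ τ!)
  with σ , refl ← unpunch v∉
  with c , refl ← decode-surjective (unique-map⁻ σ τ!)
  = v ◃ c , refl

-- The tail is the outer index, so that a sum over codes splits into the sums over the letters
-- prepended to a fixed tail, as evaluated by `weight-step`.
codes : ∀ m → List (Code m)
codes zero    = ε ∷ []
codes (suc m) = cartesianProductWith (λ c v → v ◃ c) (codes m) (allFin (suc m))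

∈-codes : (c : Code m) → c ∈ codes m
∈-codes ε       = ListAny.here refl
∈-codes (v ◃ c) = ∈-cartesianProductWith⁺ (λ c v → v ◃ c) (∈-codes c) (∈-allFin v)

codes-unique : ∀ m → ListUnique.Unique (codes m)
codes-unique zero    = ListAll.[] ListAllPairs.∷ ListAllPairs.[]
codes-unique (suc m) = ListUnique.cartesianProductWith⁺ (λ c v → v ◃ c)
  (λ { refl → refl , refl }) (codes-unique m) (ListUnique.allFin⁺ (suc m))

-- Both filtered lists are duplicate-free and have the same members, so they are rearrangements of
-- each other.
count-permutations : ∀ {P : Pred (Vec (Fin m) m) ℓ} (P? : Decidable P) → (∀ {π} → P π → Unique π) →
  count P? (words (allFin m) m) ≡ total (λ c → ⟦ P? (decode c) ⟧) (codes m)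
count-permutations {m = m} {P = P} P? P⇒! = begin
  count P? (words (allFin m) m)
    ≡⟨ ↭-length (∼bag⇒↭ (unique∧set⇒bag
         (ListUnique.filter⁺ P? (words-unique (ListUnique.allFin⁺ m) m))
         (ListUnique.filter⁺ P? (ListUnique.map⁺ decode-injective (codes-unique m)))
         (mk⇔ to from))) ⟩
  count P? (List.map decode (codes m))
    ≡⟨ count-total P? (List.map decode (codes m)) ⟩
  total (λ π → ⟦ P? π ⟧) (List.map decode (codes m))
    ≡⟨ cong sum (sym (List.map-∘ (codes m))) ⟩
  total (λ c → ⟦ P? (decode c) ⟧) (codes m) ∎
  where
  open ≡-Reasoning
  to : ∀ {π} → π ∈ filter P? (words (allFin m) m) → π ∈ filter P? (List.map decode (codes m))
  to π∈ with _ , Pπ ← ∈-filter⁻ P? {xs = words (allFin m) m} π∈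
        with c , refl ← decode-surjective (P⇒! Pπ)
    = ∈-filter⁺ P? (∈-map⁺ decode (∈-codes c)) Pπ
  from : ∀ {π} → π ∈ filter P? (List.map decode (codes m)) → π ∈ filter P? (words (allFin m) m)
  from π∈ = ∈-filter⁺ P? (∈-words-allFin _) (proj₂ (∈-filter⁻ P? {xs = List.map decode (codes m)} π∈))

-- Avoidance of 231 in terms of cuts

le : ℕ → ℕ → ℕ
le zero    _       = 1
le (suc i) zero    = 0
le (suc i) (suc j) = le i j

le-indicates : ∀ i j → Indicates (i ≤ j) (le i j)
le-indicates zero    j       = holds z≤n
le-indicates (suc i) zero    = fails λ ()
le-indicates (suc i) (suc j) = indicates-map s≤s s≤s⁻¹ (le-indicates i j)

-- 1 exactly when prepending u to the permutation coded by c creates no 231 starting there,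
-- i.e. when u is a cut of the direct sum decomposition.
site : Code m → Fin (suc m) → ℕ
site ε       u       = 1
site (w ◃ c) zero    = 1
site (w ◃ c) (suc u) = le (toℕ w) (toℕ u) * site c u

good : Code m → ℕ
good ε       = 1
good (v ◃ c) = site c v * good c

-- The letters below v precede all others; for a permutation this is a direct sum decomposition into
-- the first v letters and the rest.
Cut : Fin (suc m) → Vec (Fin m) k → Set
Cut v σ = ∀ {i j} → i Fin.< j → v Fin.≤ lookup σ i → v Fin.≤ lookup σ j

-- Weakly formulated so that no distinctness of letters is needed.
Avoids231 : Vec (Fin m) k → Set
Avoids231 π = ∀ {i j k} → i Fin.< j → j Fin.< k → lookup π i Fin.< lookup π j → lookup π i Fin.≤ lookup π k

punchIn-above : ∀ (w u : Fin (suc m)) a → w Fin.≤ u → u Fin.≤ a → toℕ u < toℕ (punchIn w a)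
punchIn-above zero    u       a       _         u≤a       = s≤s u≤a
punchIn-above (suc w) (suc u) (suc a) (s≤s w≤u) (s≤s u≤a) = s≤s (punchIn-above w u a w≤u u≤a)

punchIn-above⁻ : ∀ (w u : Fin (suc m)) a → w Fin.≤ u → toℕ u < toℕ (punchIn w a) → u Fin.≤ a
punchIn-above⁻ zero    u       a       _         (s≤s u≤a) = u≤a
punchIn-above⁻ (suc w) (suc u) (suc a) (s≤s w≤u) (s≤s u<)  = s≤s (punchIn-above⁻ w u a w≤u u<)

≤-punchIn⇒≤ : ∀ (v : Fin (suc m)) a → v Fin.≤ punchIn v a → v Fin.≤ a
≤-punchIn⇒≤ v a v≤ = punchIn-above⁻ v v a ≤-refl (≤∧≢⇒< v≤ (Fin.punchInᵢ≢i v a ∘ sym ∘ Fin.toℕ-injective))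

zero-occurs : (c : Code (suc m)) → ∃[ i ] lookup (decode c) i ≡ zero
zero-occurs (zero ◃ c)          = zero , refl
zero-occurs {suc m} (suc v ◃ c) with i , eq ← zero-occurs c =
  suc i , trans (Vec.lookup-map i _ (decode c)) (cong (punchIn (suc v)) eq)

site-indicates : (c : Code m) (u : Fin (suc m)) → Indicates (Cut u (decode c)) (site c u)
site-indicates ε       u       = holds λ { {()} }
site-indicates (w ◃ c) zero    = holds λ _ _ → z≤n
site-indicates {suc m} (w ◃ c) (suc u) with le (toℕ w) (toℕ u) | le-indicates (toℕ w) (toℕ u)
... | _ | holds w≤u = subst (Indicates _) (sym (+-identityʳ (site c u))) (indicates-map extend restrict (site-indicates c u))
  where
  σ = decode c
  extend : Cut u σ → Cut (suc u) (decode (w ◃ c))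
  extend cut {zero}  {suc j} _         u<w = contradiction u<w (≤⇒≯ w≤u)
  extend cut {suc i} {suc j} (s≤s i<j) u<i
    rewrite Vec.lookup-map i (punchIn w) σ | Vec.lookup-map j (punchIn w) σ =
    punchIn-above w u _ w≤u (cut i<j (punchIn-above⁻ w u _ w≤u u<i))
  restrict : Cut (suc u) (decode (w ◃ c)) → Cut u σ
  restrict cut {i} {j} i<j u≤i = punchIn-above⁻ w u _ w≤u
    (subst (λ a → suc (toℕ u) ≤ toℕ a) (Vec.lookup-map j (punchIn w) σ) (cut (s≤s i<j)
      (subst (λ a → suc (toℕ u) ≤ toℕ a) (sym (Vec.lookup-map i (punchIn w) σ)) (punchIn-above w u _ w≤u u≤i))))
... | _ | fails w≰u = fails (no-cut w c w≰u)
  where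
  -- Here w > u, so the first letter is above the cut, while the letter 0 occurs later and is below
  -- it.
  no-cut : ∀ {m} (w : Fin (suc m)) {u} c → ¬ (w Fin.≤ u) → ¬ Cut (suc u) (decode (w ◃ c))
  no-cut zero            c w≰u cut = w≰u z≤n
  no-cut {suc m} (suc w) {u} c w≰u cut with i , eq ← zero-occurs c
    with () ← subst (λ a → suc (toℕ u) ≤ toℕ a)
                (trans (Vec.lookup-map i (punchIn (suc w)) (decode c)) (cong (punchIn (suc w)) eq))
                (cut {zero} {suc i} (s≤s z≤n) (≰⇒> w≰u))

-- An occurrence of 231 through the first letter uses it as the 2, followed by a larger and then a
-- smaller letter, which is what a cut excludes. All other occurrences lie in the tail, whose
-- relative order `punchIn` keeps.
good-indicates : (c : Code m) → Indicates (Avoids231 (decode c)) (good c)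
good-indicates ε       = holds λ { {()} }
good-indicates (v ◃ c) = indicates-map extend restrict (indicates-× (site-indicates c v) (good-indicates c))
  where
  σ = decode c
  at : ∀ i → lookup (Vec.map (punchIn v) σ) i ≡ punchIn v (lookup σ i)
  at i = Vec.lookup-map i (punchIn v) σ
  extend : Cut v σ × Avoids231 σ → Avoids231 (decode (v ◃ c))
  extend (cut , av) {zero} {suc j} {suc k} _ (s≤s j<k) v<j rewrite at j | at k =
    <⇒≤ (punchIn-above v v _ ≤-refl (cut j<k (punchIn-above⁻ v v _ ≤-refl v<j)))
  extend (cut , av) {suc i} {suc j} {suc k} (s≤s i<j) (s≤s j<k) i<ⱼ rewrite at i | at j | at k =
    Fin.punchIn-mono-≤ v _ _ (av i<j j<k (≰⇒> λ j≤i → <⇒≱ i<ⱼ (Fin.punchIn-mono-≤ v _ _ j≤i)))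
  restrict : Avoids231 (decode (v ◃ c)) → Cut v σ × Avoids231 σ
  restrict av = cut , av′
    where
    cut : Cut v σ
    cut {i} {j} i<j v≤i = ≤-punchIn⇒≤ v _ (subst (v Fin.≤_) (at j) (av {zero} (s≤s z≤n) (s≤s i<j)
      (subst (v Fin.<_) (sym (at i)) (punchIn-above v v _ ≤-refl v≤i))))
    av′ : Avoids231 σ
    av′ {i} {j} {k} i<j j<k i<ⱼ = Fin.punchIn-cancel-≤ v _ _ (subst₂ Fin._≤_ (at i) (at k)
      (av {suc i} {suc j} {suc k} (s≤s i<j) (s≤s j<k) (subst₂ Fin._<_ (sym (at i)) (sym (at j))
        (≰⇒> λ j≤i → <⇒≱ i<ⱼ (Fin.punchIn-cancel-≤ v _ _ j≤i)))))

avoids231⇔ : (π : Vec (Fin m) m) → Avoids231 π ⇔ Avoids pattern231 π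
avoids231⇔ π = mk⇔ to from
  where
  to : Avoids231 π → Avoids pattern231 π
  to av (i ∷ j ∷ k ∷ [] , ((i<j ∷ _) ∷ (j<k ∷ []) ∷ _ ∷ []) , iso) =
    <⇒≱ (Equivalence.from (iso (suc (suc zero)) zero) (s≤s z≤n))
        (av i<j j<k (Equivalence.from (iso zero (suc zero)) (s≤s (s≤s z≤n))))
  from : Avoids pattern231 π → Avoids231 π
  from av {i} {j} {k} i<j j<k i<ⱼ = ≮⇒≥ λ k<i → av
    (i ∷ j ∷ k ∷ [] , ((i<j ∷ <-trans i<j j<k ∷ []) ∷ (j<k ∷ []) ∷ [] ∷ []) , iso k<i)
    where
    both : ∀ {P Q : Set} → P → Q → P ⇔ Q
    both p q = mk⇔ (λ _ → q) (λ _ → p)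
    neither : ∀ {P Q : Set} → ¬ P → ¬ Q → P ⇔ Q
    neither ¬p ¬q = mk⇔ (λ p → contradiction p ¬p) (λ q → contradiction q ¬q)
    iso : lookup π k Fin.< lookup π i → OrderIsomorphic (Vec.map (lookup π) (i ∷ j ∷ k ∷ [])) pattern231
    iso k<i zero             zero             = neither (<-irrefl refl) (<-irrefl refl)
    iso k<i zero             (suc zero)       = both i<ⱼ (s≤s (s≤s z≤n))
    iso k<i zero             (suc (suc zero)) = neither (<-asym k<i) λ ()
    iso k<i (suc zero)       zero             = neither (<-asym i<ⱼ) λ { (s≤s ()) }
    iso k<i (suc zero)       (suc zero)       = neither (<-irrefl refl) (<-irrefl refl)
    iso k<i (suc zero)       (suc (suc zero)) = neither (<-asym (<-trans k<i i<ⱼ)) λ ()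
    iso k<i (suc (suc zero)) zero             = both k<i (s≤s z≤n)
    iso k<i (suc (suc zero)) (suc zero)       = both (<-trans k<i i<ⱼ) (s≤s z≤n)
    iso k<i (suc (suc zero)) (suc (suc zero)) = neither (<-irrefl refl) (<-irrefl refl)

-- Ballot paths read off codes

ballot : (ℕ → ℕ) → Code (suc n) → ℕ → ℕ
ballot φ (v ◃ ε)     h = φ h
-- w is the next letter before `punchIn v` is applied, so equality also means an ascent.
ballot φ (v ◃ w ◃ c) h = if does (v Fin.≤? w) then ballot φ (w ◃ c) (suc h) else pre (ballot φ (w ◃ c)) h

ascentStep-punchIn : ∀ (v : Fin (suc m)) a b → ascentStep (punchIn v a) (punchIn v b) ≡ ascentStep a b
ascentStep-punchIn v a b = cong (λ up → if up then (1ℤ , 1ℤ) else (1ℤ , -1ℤ))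
  (does-⇔ (mk⇔ (λ a<b → ≰⇒> λ b≤a → <⇒≱ a<b (Fin.punchIn-mono-≤ v b a b≤a))
               (λ a<b → ≰⇒> λ b≤a → <⇒≱ a<b (Fin.punchIn-cancel-≤ v b a b≤a)))
          (punchIn v a Fin.<? punchIn v b) (a Fin.<? b))

steps-punchIn : ∀ (v : Fin (suc m)) (σ : Vec (Fin m) k) → steps (Vec.map (punchIn v) σ) ≡ steps σ
steps-punchIn v []          = refl
steps-punchIn v (a ∷ [])    = refl
steps-punchIn v (a ∷ b ∷ σ) = cong₂ _∷_ (ascentStep-punchIn v a b) (steps-punchIn v (b ∷ σ))

ascentStep-head : ∀ (v : Fin (suc m)) a →
  ascentStep v (punchIn v a) ≡ (if does (v Fin.≤? a) then (1ℤ , 1ℤ) else (1ℤ , -1ℤ))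
ascentStep-head v a = cong (λ up → if up then (1ℤ , 1ℤ) else (1ℤ , -1ℤ))
  (does-⇔ (mk⇔ (punchIn-above⁻ v v a ≤-refl) (punchIn-above v v a ≤-refl))
          (v Fin.<? punchIn v a) (v Fin.≤? a))

path-head : ∀ {p} (ss : Vec ℤ² n) → All NotBelowAxis (path p ss) → NotBelowAxis p
path-head []      (q ∷ _) = q
path-head (_ ∷ _) (q ∷ _) = q

BallotPath : ℕ → ℕ → Vec ℤ² n → ℕ → Set
BallotPath {n} a h ss b = All NotBelowAxis (path (+ a , + h) ss) × last (path (+ a , + h) ss) ≡ (+ (a + n) , + b)

module _ {Φ : ℕ → Set ℓ} {φ : ℕ → ℕ} (φ-indicates : ∀ h → Indicates (Φ h) (φ h)) where

  -- The abscissa a is arbitrary because the induction moves the start of the path. The condition Φ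
  -- covers a prescribed final height and a free one at once.
  ballot-indicates : ∀ (c : Code (suc n)) a h →
    Indicates (∃[ b ] Φ b × BallotPath a h (steps (decode c)) b) (ballot φ c h)
  ballot-indicates (v ◃ ε) a h = indicates-map
    (λ Φh → h , Φh , ℤ.+≤+ z≤n ∷ [] , cong (λ x → (+ x , + h)) (sym (+-identityʳ a)))
    (λ { (b , Φb , _ , end) → subst Φ (sym (ℤ.+-injective (cong proj₂ end))) Φb })
    (φ-indicates h)
  ballot-indicates {suc n} (v ◃ w ◃ c) a h
    rewrite steps-punchIn v (decode (w ◃ c)) | ascentStep-head v w with does (v Fin.≤? w)
  ... | true = subst (Indicates _) (cong (ballot φ (w ◃ c)) (+-comm h 1))
                     (indicates-map extend restrict (ballot-indicates (w ◃ c) (a + 1) (h + 1)))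
    where
    ss = steps (decode (w ◃ c))
    extend : (∃[ b ] Φ b × BallotPath (a + 1) (h + 1) ss b) → ∃[ b ] Φ b × BallotPath a h ((1ℤ , 1ℤ) ∷ ss) b
    extend (b , Φb , qs , end) = b , Φb , ℤ.+≤+ z≤n ∷ qs , trans end (cong (λ x → (+ x , + b)) (+-assoc a 1 n))
    restrict : (∃[ b ] Φ b × BallotPath a h ((1ℤ , 1ℤ) ∷ ss) b) → ∃[ b ] Φ b × BallotPath (a + 1) (h + 1) ss b
    restrict (b , Φb , _ ∷ qs , end) = b , Φb , qs , trans end (cong (λ x → (+ x , + b)) (sym (+-assoc a 1 n)))
  ... | false with h
  ...   | zero = fails λ { (b , _ , _ ∷ qs , _) → below (path-head (steps (decode (w ◃ c))) qs) }
    where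
    below : ¬ (0ℤ ℤ.≤ -1ℤ)
    below ()
  ...   | suc h = indicates-map extend restrict (ballot-indicates (w ◃ c) (a + 1) h)
    where
    ss = steps (decode (w ◃ c))
    extend : (∃[ b ] Φ b × BallotPath (a + 1) h ss b) → ∃[ b ] Φ b × BallotPath a (suc h) ((1ℤ , -1ℤ) ∷ ss) b
    extend (b , Φb , qs , end) = b , Φb , ℤ.+≤+ z≤n ∷ qs , trans end (cong (λ x → (+ x , + b)) (+-assoc a 1 n))
    restrict : (∃[ b ] Φ b × BallotPath a (suc h) ((1ℤ , -1ℤ) ∷ ss) b) → ∃[ b ] Φ b × BallotPath (a + 1) h ss b
    restrict (b , Φb , _ ∷ qs , end) = b , Φb , qs , trans end (cong (λ x → (+ x , + b)) (sym (+-assoc a 1 n)))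

-- Recursion for the weighted sums over codes

total-allFin : ∀ (f : Fin (suc n) → ℕ) → total f (allFin (suc n)) ≡ f zero + total (f ∘ suc) (allFin n)
total-allFin {n} f = cong (λ xs → f zero + sum xs)
  (trans (List.map-tabulate suc f) (sym (List.map-tabulate (λ i → i) (f ∘ suc))))

after : (Fin n → ℕ) → Fin n → ℕ
after s zero    = total (s ∘ suc) (allFin _)
after s (suc v) = after (s ∘ suc) v

total-from : ∀ (s : Fin n → ℕ) w → total (λ u → le (toℕ w) (toℕ u) * s u) (allFin n) ≡ s w + after s w
total-from s zero    = trans (total-allFin (λ u → 1 * s u))
  (cong₂ _+_ (+-identityʳ (s zero)) (total-cong (λ u → +-identityʳ (s (suc u))) (allFin _)))
total-from s (suc w) = trans (total-allFin (λ u → le (toℕ (suc w)) (toℕ u) * s u)) (total-from (s ∘ suc) w)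

-- after s runs over 0, 1, 2, … along the support of s.
hockey-stick : ∀ {S : Fin n → Set} (s : Fin n → ℕ) → (∀ v → Indicates (S v) (s v)) → ∀ i →
  total (λ v → s v * (after s v C i)) (allFin n) ≡ total s (allFin n) C suc i
hockey-stick {zero}  s ind i = sym (k>n⇒nCk≡0 {0} {suc i} (s≤s z≤n))
hockey-stick {suc n} s ind i
  rewrite total-allFin (λ v → s v * (after s v C i)) | total-allFin s
        | hockey-stick (s ∘ suc) (ind ∘ suc) i
  with s zero | ind zero
... | _ | holds _ = trans (cong (_+ (total (s ∘ suc) (allFin n) C suc i)) (+-identityʳ _))
                          (nCk+nC[k+1]≡[n+1]C[k+1] (total (s ∘ suc) (allFin n)) i)
... | _ | fails _ = refl

-- Two less than the number of cuts, if c is good.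
rank : Code (suc n) → ℕ
rank (w ◃ c) = after (site c) w

-- The summand of N(n, h, i), with final heights weighted by φ. In `gb` the index h plays the part
-- of v = x - y and i that of y.
weight : (ℕ → ℕ) → ℕ → ℕ → Code (suc n) → ℕ
weight φ h i c = good c * (ballot φ c h * (rank c C i))

total-pre : ∀ (f : ℕ → A → ℕ) k xs → total (λ x → pre (λ k → f k x) k) xs ≡ pre (λ k → total (f k) xs) k
total-pre f zero    xs = total-zero (λ _ → refl) xs
total-pre f (suc k) xs = refl

pre-cong : ∀ {f g : ℕ → ℕ} → (∀ k → f k ≡ g k) → ∀ k → pre f k ≡ pre g k
pre-cong eq zero    = refl
pre-cong eq (suc k) = eq k

module _ (φ : ℕ → ℕ) where

  -- For good c the letter zero gives an ascent and rank r + 1, where r is `rank c`. The other r + 1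
  -- cuts give descents of ranks 0, ..., r, whose binomials add up to C(r+1, i+1). Pascal's rule
  -- splits both contributions into the four GB steps.
  weight-step : ∀ h i (c : Code (suc n)) → total (λ v → weight φ h i (v ◃ c)) (allFin _)
    ≡ weight φ (suc h) i c + pre (λ i → weight φ (suc h) i c) i
    + pre (λ h → weight φ h i c + weight φ h (suc i) c) h
  weight-step {n} h i c@(w ◃ c′) with site c′ w in eq | site-indicates c′ w
  -- The first letter of c already starts a 231, so both sides vanish.
  ... | _ | fails _ = trans
    (total-zero (λ v → cong (_* (ballot φ (v ◃ c) h * (rank (v ◃ c) C i))) (*-zeroʳ (site c v))) (allFin _))
    (zeros h i)
    where
    zeros : ∀ h i → 0 ≡ 0 + pre (λ _ → 0) i + pre (λ _ → 0) h
    zeros zero    zero    = refl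
    zeros zero    (suc i) = refl
    zeros (suc h) zero    = refl
    zeros (suc h) (suc i) = refl
  ... | _ | holds _ = begin
    total (λ v → weight′ v) (allFin _)     ≡⟨ total-allFin weight′ ⟩
    weight′ zero + total (weight′ ∘ suc) (allFin _)
      ≡⟨ cong₂ _+_ first (trans (total-cong rest (allFin _)) (total-* (g * pre b h) (λ u → s u * (after s u C i)) (allFin _))) ⟩
    g * (b (suc h) * (suc (rank c) C i)) + g * pre b h * total (λ u → s u * (after s u C i)) (allFin _)
      ≡⟨ cong (λ t → g * (b (suc h) * (suc (rank c) C i)) + g * pre b h * t)
           (trans (hockey-stick s (λ u → site-indicates c (suc u)) i) (trans (cong (_C suc i) cuts) (pascal (rank c) (suc i)))) ⟩
    g * (b (suc h) * (suc (rank c) C i)) + g * pre b h * ((rank c C i) + (rank c C suc i))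
      ≡⟨ cong (λ t → g * (b (suc h) * t) + g * pre b h * ((rank c C i) + (rank c C suc i))) (pascal (rank c) i) ⟩
    g * (b (suc h) * (pre (rank c C_) i + (rank c C i))) + g * pre b h * ((rank c C i) + (rank c C suc i))
      ≡⟨ distribute h i ⟩
    g * (b (suc h) * (rank c C i)) + pre (λ i → g * (b (suc h) * (rank c C i))) i
      + pre (λ h → g * (b h * (rank c C i)) + g * (b h * (rank c C suc i))) h ∎
    where
    open ≡-Reasoning
    -- The factor 1 is `site c′ w` after the `with`.
    g = 1 * good c′
    b = ballot φ c
    s : Fin (suc n) → ℕ
    s u = site c (suc u)
    weight′ : Fin (suc (suc n)) → ℕ
    weight′ v = site c v * g * (ballot φ (v ◃ c) h * (rank (v ◃ c) C i))
    cuts : total s (allFin _) ≡ suc (rank c)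
    -- A positive cut of c is `suc u` for a cut u ≥ w of the tail: w itself, or one of the `rank c`
    -- cuts beyond it.
    cuts = trans (total-from (site c′) w) (cong (_+ rank c) eq)
    first : weight′ zero ≡ g * (b (suc h) * (suc (rank c) C i))
    first = cong₂ (λ x y → x * (b (suc h) * (y C i))) (+-identityʳ g) cuts
    rest : ∀ u → weight′ (suc u) ≡ g * pre b h * (s u * (after s u C i))
    rest u with le (toℕ w) (toℕ u) | le-indicates (toℕ w) (toℕ u)
    ... | _ | fails _   = sym (*-zeroʳ (g * pre b h))
    -- A positive cut exceeds w, so prepending it makes a descent.
    ... | _ | holds w≤u rewrite dec-false (suc u Fin.≤? w) (≤⇒≯ w≤u) =
      ring (1 * site c′ u) g (pre b h) (after s u C i)
      where
      ring : ∀ s g b r → s * g * (b * r) ≡ g * b * (s * r)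
      ring = solve-∀
    distribute : ∀ h i → g * (b (suc h) * (pre (rank c C_) i + (rank c C i))) + g * pre b h * ((rank c C i) + (rank c C suc i))
      ≡ g * (b (suc h) * (rank c C i)) + pre (λ i → g * (b (suc h) * (rank c C i))) i
        + pre (λ h → g * (b h * (rank c C i)) + g * (b h * (rank c C suc i))) h
    distribute zero    zero    = ring g (b 1) (rank c C 0) (rank c C 1)
      where
      ring : ∀ g b x y → g * (b * (0 + x)) + g * 0 * (x + y) ≡ g * (b * x) + 0 + 0
      ring = solve-∀
    distribute zero    (suc i) = ring g (b 1) (rank c C i) (rank c C suc i) (rank c C suc (suc i))
      where
      ring : ∀ g b w x y → g * (b * (w + x)) + g * 0 * (x + y) ≡ g * (b * x) + g * (b * w) + 0
      ring = solve-∀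
    distribute (suc h) zero    = ring g (b (2 + h)) (b h) (rank c C 0) (rank c C 1)
      where
      ring : ∀ g b b′ x y → g * (b * (0 + x)) + g * b′ * (x + y) ≡ g * (b * x) + 0 + (g * (b′ * x) + g * (b′ * y))
      ring = solve-∀
    distribute (suc h) (suc i) = ring g (b (2 + h)) (b h) (rank c C i) (rank c C suc i) (rank c C suc (suc i))
      where
      ring : ∀ g b b′ w x y → g * (b * (w + x)) + g * b′ * (x + y) ≡ g * (b * x) + g * (b * w) + (g * (b′ * x) + g * (b′ * y))
      ring = solve-∀

  -- For n = 0 the only code has rank 0, and C(0, i) leaves just i = 0, as the empty walk must
  -- already be on the x-axis. Afterwards `weight-step` is the recursion of `gb`.
  total-weight : ∀ n h i → total (weight φ h i) (codes (suc n)) ≡ gb φ n h i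
  total-weight zero h zero    = ring (φ h)
    where
    ring : ∀ x → 1 * (x * 1) + 0 ≡ x
    ring = solve-∀
  total-weight zero h (suc i) = trans (+-identityʳ _) (trans (+-identityʳ _)
    (trans (cong (φ h *_) (k>n⇒nCk≡0 {0} {suc i} (s≤s z≤n))) (*-zeroʳ (φ h))))
  total-weight (suc n) h i = begin
    total (weight φ h i) (codes (2 + n))
      ≡⟨ total-cartesianProductWith (weight φ h i) (λ c v → v ◃ c) (codes (suc n)) (allFin (2 + n)) ⟩
    total (λ c → total (λ v → weight φ h i (v ◃ c)) (allFin (2 + n))) cs
      ≡⟨ total-cong (weight-step h i) cs ⟩
    total (λ c → weight φ (suc h) i c + pre (λ i → weight φ (suc h) i c) i
               + pre (λ h → weight φ h i c + weight φ h (suc i) c) h) cs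
      ≡⟨ trans (total-+ _ _ cs) (cong₂ _+_
           (trans (total-+ _ _ cs) (cong₂ _+_ (total-weight n (suc h) i)
             (trans (total-pre (λ i → weight φ (suc h) i) i cs) (pre-cong (total-weight n (suc h)) i))))
           (trans (total-pre (λ h c → weight φ h i c + weight φ h (suc i) c) h cs)
             (pre-cong (λ h → trans (total-+ _ _ cs) (cong₂ _+_ (total-weight n h i) (total-weight n h (suc i)))) h))) ⟩
    gb φ (suc n) h i ∎
    where
    open ≡-Reasoning
    cs = codes (suc n)

  total-good-ballot : ∀ n h → total (λ c → good c * ballot φ c h) (codes (suc n)) ≡ gb φ n h 0
  total-good-ballot n h = trans
    (total-cong (λ c → cong (good c *_) (sym (*-identityʳ (ballot φ c h)))) (codes (suc n)))
    (total-weight n h 0)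

-- The permutation counts as values of `gb`

G-gb : ∀ n h b → G n h b ≡ gb (δ b) n h 0
G-gb n h b = trans
  (count-permutations {m = suc n} (λ π → isBallotFromTo? h b π ×-dec avoids? pattern231 π) (IsBallotFromTo.isPermutation ∘ proj₁))
  (trans (total-cong (λ c → indicates-unique
      (⟦⟧-indicates (isBallotFromTo? h b (decode c) ×-dec avoids? pattern231 (decode c)))
      (indicates-map (to c) (from c) (indicates-× (good-indicates c) (ballot-indicates (δ-indicates b) c 0 h))))
    (codes (suc n)))
  (total-good-ballot (δ b) n h))
  where
  to : ∀ (c : Code (suc n)) → Avoids231 (decode c) × (∃[ b′ ] b′ ≡ b × BallotPath 0 h (steps (decode c)) b′) →
       IsBallotFromTo h b (decode c) × Avoids pattern231 (decode c)
  to c (av , _ , refl , qs , end) = mkBallot (decode-unique c) end qs , Equivalence.to (avoids231⇔ (decode c)) av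
  from : ∀ (c : Code (suc n)) → IsBallotFromTo h b (decode c) × Avoids pattern231 (decode c) →
         Avoids231 (decode c) × (∃[ b′ ] b′ ≡ b × BallotPath 0 h (steps (decode c)) b′)
  from c (mkBallot _ end qs , av) = Equivalence.from (avoids231⇔ (decode c)) av , b , refl , qs , end

numBallot231-gb : ∀ n → numBallot231 (suc n) ≡ gb (const 1) n 0 0
numBallot231-gb n = trans
  (count-permutations {m = suc n} (λ π → isBallot? π ×-dec avoids? pattern231 π) (IsBallotFromTo.isPermutation ∘ proj₂ ∘ proj₁))
  (trans (total-cong (λ c → indicates-unique
      (⟦⟧-indicates (isBallot? (decode c) ×-dec avoids? pattern231 (decode c)))
      (indicates-map (to c) (from c)
        (indicates-× (good-indicates c) (ballot-indicates {Φ = λ _ → ⊤} (λ _ → holds tt) c 0 0))))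
    (codes (suc n)))
  (total-good-ballot (const 1) n 0))
  where
  to : ∀ (c : Code (suc n)) → Avoids231 (decode c) × (∃[ b ] ⊤ × BallotPath 0 0 (steps (decode c)) b) →
       IsBallot (decode c) × Avoids pattern231 (decode c)
  to c (av , b , _ , qs , end) = (b , mkBallot (decode-unique c) end qs) , Equivalence.to (avoids231⇔ (decode c)) av
  from : ∀ (c : Code (suc n)) → IsBallot (decode c) × Avoids pattern231 (decode c) →
         Avoids231 (decode c) × (∃[ b ] ⊤ × BallotPath 0 0 (steps (decode c)) b)
  from c ((b , mkBallot _ end qs) , av) = Equivalence.from (avoids231⇔ (decode c)) av , b , tt , qs , end

theorem4p6 : (∀ (n h b : ℕ) → G n h b ≡ H n h b) ×
    (∀ (n : ℕ) → 1 ≤ n → numBallot231 n ≡ catalan (n / 2) * catalan ((n + 1) / 2))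
theorem4p6 =
    (λ n h b → trans (G-gb n h b) (sym (H-gb n h b)))
  , λ { (suc n) _ → trans (numBallot231-gb n) (gb-catalan n) }
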